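{- Let $\mathcal{P}$ be a finite poset, let $m$ be a positive integer, and let $\mathcal{C}_m$ be the chain with $m$ elements on the ground set $\{1,2,\ldots,m\}$. Then there is an isomorphism of posets $\mathcal{I}(\mathcal{P}\times\mathcal{C}_m)\cong\mathcal{I}(\mathcal{P})^{[m]}$.
   Context: For a poset $\mathcal{Q}=(Q,\leq)$, a set $I\subseteq Q$ is an order ideal if $y\in I$ and $x\leq y$ imply $x\in I$; $\mathcal{I}(\mathcal{Q})$ denotes the set of all order ideals of $\mathcal{Q}$, partially ordered by inclusion. The direct product $\mathcal{P}\times\mathcal{Q}$ carries the componentwise order. For a poset $\mathcal{Q}=(Q,\leq)$ and an integer $m>0$, the poset of $m$-multichains $\mathcal{Q}^{[m]}$ is the set $\{(x_1,\ldots,x_m)\in Q^m\mid x_1\leq x_2\leq\cdots\leq x_m\}$ with the componentwise order. -}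

module Defs where

open import Data.Fin.Base using (Fin)
import Data.Fin.Properties as Fin
open import Data.Nat.Base using (ℕ)
open import Data.Product.Base using (Σ; Σ-syntax; ∃-syntax; proj₁)
open import Data.Vec.Base using (Vec; []; _∷_)
open import Data.Vec.Relation.Binary.Pointwise.Inductive as Pointwise
  using (Pointwise; []; _∷_)
open import Data.Vec.Relation.Unary.Linked using (Linked)
open import Function.Bundles using (Inverse)
open import Level using (Level; _⊔_; suc; 0ℓ)
open import Relation.Binary.Bundles using (Poset)
import Relation.Binary.Construct.On as On
open import Relation.Binary.Morphism.Structures using (IsOrderIsomorphism)
import Relation.Binary.PropositionalEquality.Properties as ≡
open import Relation.Unary using (Pred; _∈_)
open import Relation.Unary.Relation.Binary.Subset using (⊆-poset)

private
  variable
    c ℓ₁ ℓ₂ c′ ℓ₁′ ℓ₂′ : Level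

Finite : Poset c ℓ₁ ℓ₂ → Set (c ⊔ ℓ₁)
Finite P = ∃[ n ] Inverse (Poset.Eq.setoid P) (≡.setoid (Fin n))

infix 4 _≅_

_≅_ : Poset c ℓ₁ ℓ₂ → Poset c′ ℓ₁′ ℓ₂′ → Set (c ⊔ ℓ₁ ⊔ ℓ₂ ⊔ c′ ⊔ ℓ₁′ ⊔ ℓ₂′)
P ≅ Q = Σ[ f ∈ (P.Carrier → Q.Carrier) ]
          IsOrderIsomorphism P._≈_ Q._≈_ P._≤_ Q._≤_ f
  where
  module P = Poset P
  module Q = Poset Q

-- The element i : Fin m stands for the element 1 + toℕ i of {1, …, m}.
Chain : ℕ → Poset 0ℓ 0ℓ 0ℓ
Chain = Fin.≤-poset

-- Subsets are predicates valued in Set ℓ, for an arbitrary level ℓ.  A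
-- downward closed predicate respects _≈_, since x ≈ y implies x ≤ y, so
-- this need not be required separately.
record OrderIdeal (Q : Poset c ℓ₁ ℓ₂) (ℓ : Level) : Set (c ⊔ ℓ₂ ⊔ suc ℓ) where
  open Poset Q using (Carrier; _≤_)
  field
    members    : Pred Carrier ℓ
    downClosed : ∀ {x y} → y ∈ members → x ≤ y → x ∈ members

-- Equality of ideals is extensional: mutual inclusion.
𝓘 : Poset c ℓ₁ ℓ₂ → (ℓ : Level) → Poset (c ⊔ ℓ₂ ⊔ suc ℓ) (c ⊔ ℓ) (c ⊔ ℓ)
𝓘 Q ℓ = On.poset (⊆-poset (Poset.Carrier Q) ℓ) (OrderIdeal.members {Q = Q})

vecPoset : Poset c ℓ₁ ℓ₂ → ℕ → Poset c (c ⊔ ℓ₁) (c ⊔ ℓ₂)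
vecPoset Q m = record
  { Carrier        = Vec Q.Carrier m
  ; _≈_            = Pointwise Q._≈_
  ; _≤_            = Pointwise Q._≤_
  ; isPartialOrder = record
    { isPreorder = record
      { isEquivalence = Pointwise.isEquivalence Q.isEquivalence m
      ; reflexive     = Pointwise.map Q.reflexive
      ; trans         = Pointwise.trans Q.trans
      }
    ; antisym = antisym
    }
  }
  where
  module Q = Poset Q

  antisym : ∀ {n} {xs ys : Vec Q.Carrier n} →
            Pointwise Q._≤_ xs ys → Pointwise Q._≤_ ys xs → Pointwise Q._≈_ xs ys
  antisym []            []            = []
  antisym (x≤y ∷ xs≤ys) (y≤x ∷ ys≤xs) = Q.antisym x≤y y≤x ∷ antisym xs≤ys ys≤xs

Multichain : Poset c ℓ₁ ℓ₂ → ℕ → Set (c ⊔ ℓ₂)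
Multichain Q m = Σ (Vec Q.Carrier m) (Linked Q._≤_)
  where module Q = Poset Q

infix 8 _^[_]

_^[_] : Poset c ℓ₁ ℓ₂ → ℕ → Poset (c ⊔ ℓ₂) (c ⊔ ℓ₁) (c ⊔ ℓ₂)
Q ^[ m ] = On.poset {B = Multichain Q m} (vecPoset Q m) proj₁

{-# OPTIONS --safe #-}

-- An order ideal I of P × Cₘ is determined by its slices
-- Iₖ = { p | (p , k) ∈ I }.  These are ideals of P that shrink as k grows, so
-- listing them from k = m down to k = 1 gives the multichain.

module Submission where

open import Defs
open import Data.Fin.Base using (Fin; zero; suc; opposite; _≤_)
open import Data.Fin.Properties using (opposite-prop; opposite-involutive; ≤-refl)
open import Data.Nat.Base using (ℕ; NonZero; zero; suc; z≤n; s≤s; s≤s⁻¹)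
open import Data.Nat.Properties using (∸-monoʳ-≤)
open import Data.Product.Base using (_,_)
open import Data.Product.Relation.Binary.Pointwise.NonDependent using (×-poset)
open import Data.Vec.Base using (Vec; _∷_; tabulate; lookup)
open import Data.Vec.Properties using (tabulate∘lookup)
open import Data.Vec.Relation.Binary.Pointwise.Inductive as Pointwise using (Pointwise)
import Data.Vec.Relation.Unary.All.Properties as All
open import Data.Vec.Relation.Unary.Linked using (Linked; []; [-]; _∷_)
open import Data.Vec.Relation.Unary.Linked.Properties using (Linked⇒All)
open import Function.Base using (id; _∘_)
open import Function.Consequences using (strictlySurjective⇒surjective)
open import Function.Definitions using (Congruent; Injective; StrictlySurjective)
open import Level using (Level)
open import Relation.Binary.Bundles using (Poset)
open import Relation.Binary.Core using (Rel)
open import Relation.Binary.Definitions using (Reflexive; Transitive)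
open import Relation.Binary.PropositionalEquality.Core using (subst)

-- Conversely, a multichain of ideals glues to the set of pairs `(p , k)` with `p` in the entry at
-- position `opposite k`; monotonicity of the multichain makes this set closed downwards in the
-- chain direction. Inclusion of ideals of the product can be tested slice by slice, so slicing both
-- preserves and reflects the order, and slicing a glued ideal returns the multichain. A surjective
-- map that preserves and reflects the order is an isomorphism.

private
  variable
    a c c′ ℓ ℓ₁ ℓ₂ ℓ₁′ ℓ₂′ : Level
    n : ℕ

opposite-anti-≤ : ∀ {i j : Fin n} → i ≤ j → opposite j ≤ opposite i
opposite-anti-≤ {n} {i} {j} i≤j
  -- Here `opposite i` has value `n ∸ suc (toℕ i)`, so the claim is antitonicity of subtraction in
  -- its second argument.
  rewrite opposite-prop i | opposite-prop j = ∸-monoʳ-≤ n (s≤s i≤j)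

module _ {A : Set a} {R : Rel A ℓ} where

  Linked-tabulate⁺ : ∀ {n} {f : Fin n → A} →
                     (∀ {i j} → i ≤ j → R (f i) (f j)) → Linked R (tabulate f)
  Linked-tabulate⁺ {zero}        mono = []
  Linked-tabulate⁺ {suc zero}    mono = [-]
  Linked-tabulate⁺ {suc (suc n)} mono =
    mono {zero} {suc zero} z≤n ∷ Linked-tabulate⁺ (λ i≤j → mono (s≤s i≤j))

  -- `Linked` compares neighbours only: transitivity carries the head to every later entry, and
  -- reflexivity covers the head itself.
  Linked-lookup-≤ : Reflexive R → Transitive R → ∀ {xs : Vec A n} → Linked R xs →
                    ∀ {i j} → i ≤ j → R (lookup xs i) (lookup xs j)
  Linked-lookup-≤ rfl trans {_ ∷ _} Rxs       {zero}  {j}     _   =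
    All.lookup⁺ (Linked⇒All trans rfl Rxs) j
  Linked-lookup-≤ rfl trans         (_ ∷ Rxs) {suc i} {suc j} i≤j =
    Linked-lookup-≤ rfl trans Rxs (s≤s⁻¹ i≤j)

  Pointwise-tabulate-lookup : ∀ {f : Fin n → A} (ys : Vec A n) →
                              (∀ i → R (f i) (lookup ys i)) → Pointwise R (tabulate f) ys
  Pointwise-tabulate-lookup ys f∼ys =
    subst (Pointwise R _) (tabulate∘lookup ys) (Pointwise.tabulate⁺ f∼ys)

module _ (P : Poset c ℓ₁ ℓ₂) (Q : Poset c′ ℓ₁′ ℓ₂′) where
  private
    module P = Poset P
    module Q = Poset Q

  -- `Injective` at the two orders means order reflection. By antisymmetry, equality is `≤` both
  -- ways, so congruence and injectivity for `≈` follow.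
  surjectiveEmbedding⇒≅ : (f : P.Carrier → Q.Carrier) →
                          Congruent P._≤_ Q._≤_ f → Injective P._≤_ Q._≤_ f →
                          StrictlySurjective Q._≈_ f → P ≅ Q
  surjectiveEmbedding⇒≅ f mono cancel surj = f , record
    { isOrderMonomorphism = record
      { isOrderHomomorphism = record { cong = f-cong ; mono = mono }
      ; injective           = λ fx≈fy → P.antisym (cancel (Q.reflexive fx≈fy))
                                                  (cancel (Q.reflexive (Q.Eq.sym fx≈fy)))
      ; cancel              = cancel
      }
    ; surjective = strictlySurjective⇒surjective {≈₂ = Q._≈_} {≈₁ = P._≈_} Q.Eq.trans f-cong surj
    }
    where
    f-cong : Congruent P._≈_ Q._≈_ f
    f-cong x≈y = Q.antisym (mono (P.reflexive x≈y)) (mono (P.reflexive (P.Eq.sym x≈y)))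

module _ (P : Poset c ℓ₁ ℓ₂) (m : ℕ) (ℓ : Level) where
  private
    module P    = Poset P
    module 𝓘P   = Poset (𝓘 P ℓ)
    module 𝓘P×C = Poset (𝓘 (×-poset P (Chain m)) ℓ)
    module M    = Poset (𝓘 P ℓ ^[ m ])

  open OrderIdeal

  slice : 𝓘P×C.Carrier → Fin m → 𝓘P.Carrier
  slice I k = record
    { members    = λ p → members I (p , k)
    ; downClosed = λ y∈I x≤y → downClosed I y∈I (x≤y , ≤-refl)
    }

  slice-anti : ∀ I {j k} → j ≤ k → slice I k 𝓘P.≤ slice I j
  slice-anti I j≤k p∈I = downClosed I p∈I (P.refl , j≤k)

  slices : 𝓘P×C.Carrier → M.Carrier
  slices I = tabulate (slice I ∘ opposite)
           , Linked-tabulate⁺ (λ i≤j → slice-anti I (opposite-anti-≤ i≤j))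

  slices-mono : Congruent 𝓘P×C._≤_ M._≤_ slices
  slices-mono I⊆J = Pointwise.tabulate⁺ (λ _ → I⊆J)

  slices-cancel : Injective 𝓘P×C._≤_ M._≤_ slices
  slices-cancel {I} {J} I≤J {p , k} =
    -- The entry at position `opposite k` is the slice at `opposite (opposite k)`, which equals `k`
    -- only propositionally.
    subst (λ i → members I (p , i) → members J (p , i)) (opposite-involutive k)
          (Pointwise.tabulate⁻ I≤J (opposite k))

  glue : M.Carrier → 𝓘P×C.Carrier
  glue (Is , linked) = record
    { members    = λ (p , k) → members (lookup Is (opposite k)) p
    ; downClosed = λ {_} {(_ , k)} y∈I (x≤y , j≤k) →
        -- Descend in `P` inside one entry, then pass to the larger ideal at the later position
        -- `opposite j`.
        Linked-lookup-≤ {R = 𝓘P._≤_} id (λ I⊆J J⊆K → J⊆K ∘ I⊆J) linked (opposite-anti-≤ j≤k)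
          (downClosed (lookup Is (opposite k)) y∈I x≤y)
    }

  -- Reversing twice restores every entry. Equality of multichains looks only at the vectors, so the
  -- linkedness proofs need no comparison.
  slices∘glue : ∀ Js → slices (glue Js) M.≈ Js
  slices∘glue Js@(Is , _) = Pointwise-tabulate-lookup Is λ i →
    subst (λ k → slice (glue Js) (opposite i) 𝓘P.≈ lookup Is k)
          (opposite-involutive i) (id , id)

theorem4p1 : ∀ {c ℓ₁ ℓ₂ : Level} (ℓ : Level) (P : Poset c ℓ₁ ℓ₂) → Finite P →
    (m : ℕ) .{{_ : NonZero m}} →
    𝓘 (×-poset P (Chain m)) ℓ ≅ (𝓘 P ℓ) ^[ m ]
theorem4p1 ℓ P _ m =
  surjectiveEmbedding⇒≅ (𝓘 (×-poset P (Chain m)) ℓ) (𝓘 P ℓ ^[ m ]) (slices P m ℓ)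
    (λ {I} {J} → slices-mono P m ℓ {I} {J})
    (λ {I} {J} → slices-cancel P m ℓ {I} {J})
    (λ Js → glue P m ℓ Js , slices∘glue P m ℓ Js)
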